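{- Let $v\ge2$. Then an optimum $(d,3)$-CDA$((d+1)v^3;4,v)$ exists for every positive integer $d$ with $d+1\le v$.
   Context: Consecutive $t$-way interaction in an $N\times k$ array $A=(a_{ij})$ over a $v$-set $V$: $T=\{(i,x_i),\dots,(i+t-1,x_{i+t-1})\}$, $1\le i\le k-t+1$, $x_r\in V$; $\rho(A,T)=\{r: a_{r,j}=x_j\ \forall (j,x_j)\in T\}$, $\rho(A,\mathcal T)=\bigcup_{T\in\mathcal T}\rho(A,T)$. A $(d,t)$-CDA$(N;k,v)$ is an $N\times k$ array over $V$ in which every $t$ consecutive columns contain every $t$-tuple at least once, and such that for every set $\mathcal T$ of exactly $d$ distinct consecutive $t$-way interactions and every consecutive $t$-way interaction $T$: $\rho(A,T)\subseteq\rho(A,\mathcal T)$ iff $T\in\mathcal T$. It is optimum if $N=(d+1)v^t$. -}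

module Defs where

open import Data.Fin using (Fin; toℕ)
open import Data.Nat using (ℕ; suc; _+_; _*_; _∸_; _^_)
open import Data.Product using (_×_; _,_; ∃-syntax)
open import Data.Vec using (Vec; lookup)
open import Data.Vec.Membership.Propositional using (_∈_)
open import Data.Vec.Relation.Unary.Unique.Propositional using (Unique)
open import Function.Bundles using (_⇔_)
open import Level using (0ℓ)
open import Relation.Binary.PropositionalEquality using (_≡_)
open import Relation.Unary using (Pred; _⊆_; Satisfiable)

-- The v-set of symbols is Fin v; rows and columns are numbered from 0.
Array : ℕ → ℕ → ℕ → Set
Array N k v = Fin N → Fin k → Fin v

-- (i , x₀ ∷ … ∷ xₜ₋₁) encodes {(i, x₀), …, (i + t − 1, xₜ₋₁)}.  There are
-- suc k ∸ t starting columns, hence none when t > k.  For t ≥ 1 the encoding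
-- is injective, so distinct interactions are exactly distinct pairs.
Interaction : ℕ → ℕ → ℕ → Set
Interaction t k v = Fin (suc k ∸ t) × Vec (Fin v) t

module _ {t k v : ℕ} where

  infix 4 _∈ᵢ_

  _∈ᵢ_ : Fin k × Fin v → Interaction t k v → Set
  (j , y) ∈ᵢ (i , x) = ∃[ p ] (toℕ j ≡ toℕ i + toℕ p × y ≡ lookup x p)

  module _ {N : ℕ} (A : Array N k v) where

    ρ : Interaction t k v → Pred (Fin N) 0ℓ
    ρ T r = ∀ {j y} → (j , y) ∈ᵢ T → A r j ≡ y

    ρ⋃ : ∀ {d} → Vec (Interaction t k v) d → Pred (Fin N) 0ℓ
    ρ⋃ 𝒯 r = ∃[ T ] (T ∈ 𝒯 × ρ T r)

-- A set of exactly d interactions is a duplicate-free vector of length d.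
record IsCDA (d t : ℕ) {N k v : ℕ} (A : Array N k v) : Set where
  field
    covering  : (T : Interaction t k v) → Satisfiable (ρ A T)
    detecting : (𝒯 : Vec (Interaction t k v) d) → Unique 𝒯 →
                (T : Interaction t k v) → (ρ A T ⊆ ρ⋃ A 𝒯) ⇔ (T ∈ 𝒯)

record IsOptimumCDA (d t : ℕ) {N k v : ℕ} (A : Array N k v) : Set where
  field
    isCDA   : IsCDA d t A
    optimum : N ≡ (d + 1) * v ^ t

{-# OPTIONS --safe #-}

-- The rows of the array are (a , b , c , e) for all a, b, c and all e with
-- a + e ≡ s (mod v) for some s ≤ d.  Any two of a, e, s determine the third, so
-- the d + 1 rows containing a given interaction T carry the labels s = 0, …, d,
-- and two of them never agree in both outer columns.  An interaction other than
-- T thus contains at most one of these rows, and d of them cannot contain all.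
module Submission where

open import Data.Fin using (Fin; zero; suc; toℕ; inject≤; inject₁; combine; remQuot; finToFun; funToFin; _↑ʳ_) renaming (_<_ to _<ᶠ_)
open import Data.Fin.Patterns using (0F; 1F; 2F; 3F)
open import Data.Fin.Properties using (toℕ-injective; toℕ<n; toℕ-fromℕ<; toℕ-inject₁; inject≤-injective; pigeonhole; <⇒≢; remQuot-combine; finToFun-funToFin)
open import Data.Nat using (ℕ; suc; _+_; _*_; _∸_; _^_; _≤_; _<_; s≤s; z≤n; NonZero)
open import Data.Nat.DivMod using (_%_; _mod_; m%n<n; m%n%n≡m%n; m<n⇒m%n≡m; [m+n]%n≡m%n; %-distribˡ-+)
open import Data.Nat.Properties using (+-comm; +-assoc; <⇒≤; m+[n∸m]≡n; m∸n+n≡m; m<m+n)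
open import Data.Product using (Σ-syntax; ∃-syntax; _×_; _,_; proj₁; proj₂)
open import Data.Sum using (_⊎_; inj₁; inj₂)
open import Data.Vec using (Vec; []; _∷_; lookup)
open import Data.Vec.Membership.Propositional using (_∈_)
open import Data.Vec.Relation.Binary.Pointwise.Extensional using (ext; Pointwise-≡⇒≡)
open import Data.Vec.Relation.Unary.Any using (index)
open import Data.Vec.Relation.Unary.Any.Properties using (lookup-index)
open import Function.Bundles using (mk⇔)
open import Relation.Binary.PropositionalEquality using (_≡_; _≢_; refl; sym; trans; cong; cong₂; subst; module ≡-Reasoning)
open import Relation.Nullary using (contradiction)
open import Relation.Unary using (_⊆_)
open import Defs

module _ {t k v N d : ℕ} (A : Array N k v)
         (row : Interaction t k v → Fin (d + 1) → Fin N)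
         (row-ρ : ∀ T s → ρ A T (row T s))
         (row-separated : ∀ T T′ {s s′} → s ≢ s′ →
                          ρ A T′ (row T s) → ρ A T′ (row T s′) → T′ ≡ T)
         where

  -- Each of the `d + 1` rows `row T s` is assigned the position of a member of `𝒯` containing it.
  -- By pigeonhole two labels share a position, so one member contains two of these rows and
  -- `row-separated` identifies it with `T`.
  ρ⊆ρ⋃⇒∈ : (𝒯 : Vec (Interaction t k v) d) (T : Interaction t k v) →
           ρ A T ⊆ ρ⋃ A 𝒯 → T ∈ 𝒯
  ρ⊆ρ⋃⇒∈ 𝒯 T sub = conclude (pigeonhole (m<m+n d (s≤s z≤n)) pos)
    where
    hit : ∀ s → ρ⋃ A 𝒯 (row T s)
    hit s = sub (row-ρ T s)

    pos : Fin (d + 1) → Fin d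
    pos s = index (proj₁ (proj₂ (hit s)))

    hit≡lookup : ∀ s → proj₁ (hit s) ≡ lookup 𝒯 (pos s)
    hit≡lookup s = lookup-index (proj₁ (proj₂ (hit s)))

    conclude : (∃[ s ] ∃[ s′ ] (s <ᶠ s′ × pos s ≡ pos s′)) → T ∈ 𝒯
    conclude (s , s′ , s<s′ , eq) =
      subst (_∈ 𝒯) (row-separated T _ (<⇒≢ s<s′) (proj₂ (proj₂ (hit s))) same)
            (proj₁ (proj₂ (hit s)))
      where
      hit≡hit : proj₁ (hit s′) ≡ proj₁ (hit s)
      hit≡hit = trans (hit≡lookup s′) (trans (cong (lookup 𝒯) (sym eq)) (sym (hit≡lookup s)))

      same : ρ A (proj₁ (hit s)) (row T s′)
      same = subst (λ T′ → ρ A T′ (row T s′)) hit≡hit (proj₂ (proj₂ (hit s′)))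

  separated⇒IsCDA : IsCDA d t A
  separated⇒IsCDA = record
    -- Any label would do; `d ↑ʳ zero` is the last one, `s = d`.
    { covering  = λ T → row T (d ↑ʳ zero) , row-ρ T (d ↑ʳ zero)
    ; detecting = λ 𝒯 _ T → mk⇔ (ρ⊆ρ⋃⇒∈ 𝒯 T) λ T∈𝒯 r∈ρ → T , T∈𝒯 , r∈ρ
    }

module _ {n : ℕ} .{{_ : NonZero n}} where

  -- The two shifts add up to `n`, a full turn modulo `n`; reducing in between changes nothing.
  %-cancel-complement : ∀ {u x y} → u < n → x + y ≡ n → ((u + x) % n + y) % n ≡ u
  %-cancel-complement {u} {x} {y} u<n x+y≡n = begin
    ((u + x) % n + y) % n              ≡⟨ %-distribˡ-+ ((u + x) % n) y n ⟩
    ((u + x) % n % n + y % n) % n      ≡⟨ cong (λ z → (z + y % n) % n) (m%n%n≡m%n (u + x) n) ⟩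
    ((u + x) % n + y % n) % n          ≡⟨ %-distribˡ-+ (u + x) y n ⟨
    (u + x + y) % n                    ≡⟨ cong (_% n) (+-assoc u x y) ⟩
    (u + (x + y)) % n                  ≡⟨ cong (λ z → (u + z) % n) x+y≡n ⟩
    (u + n) % n                        ≡⟨ [m+n]%n≡m%n u n ⟩
    u % n                              ≡⟨ m<n⇒m%n≡m u<n ⟩
    u                                  ∎
    where open ≡-Reasoning

  infixl 6 _⊖_

  -- Subtraction modulo `n`. Since `toℕ a < n`, the inner `∸` never truncates.
  _⊖_ : Fin n → Fin n → Fin n
  s ⊖ a = (toℕ s + (n ∸ toℕ a)) mod n

  toℕ-⊖ : ∀ s a → toℕ (s ⊖ a) ≡ (toℕ s + (n ∸ toℕ a)) % n
  toℕ-⊖ s a = toℕ-fromℕ< (m%n<n (toℕ s + (n ∸ toℕ a)) n)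

  ⊖-+ : ∀ s a → (toℕ (s ⊖ a) + toℕ a) % n ≡ toℕ s
  ⊖-+ s a = trans (cong (λ z → (z + toℕ a) % n) (toℕ-⊖ s a))
                  (%-cancel-complement (toℕ<n s) (m∸n+n≡m (<⇒≤ (toℕ<n a))))

  ⊖-cancelʳ : ∀ {s s′} a → s ⊖ a ≡ s′ ⊖ a → s ≡ s′
  ⊖-cancelʳ {s} {s′} a eq = toℕ-injective (begin
    toℕ s                        ≡⟨ ⊖-+ s a ⟨
    (toℕ (s ⊖ a) + toℕ a) % n    ≡⟨ cong (λ e → (toℕ e + toℕ a) % n) eq ⟩
    (toℕ (s′ ⊖ a) + toℕ a) % n   ≡⟨ ⊖-+ s′ a ⟩
    toℕ s′                       ∎)
    where open ≡-Reasoning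

  -- The map `a ↦ s - a` is a reflection of the residues. It lets the first entry of a row be solved
  -- from its last one.
  ⊖-involutive : ∀ s a → s ⊖ (s ⊖ a) ≡ a
  ⊖-involutive s a = toℕ-injective (begin
    toℕ (s ⊖ e)                                    ≡⟨ toℕ-⊖ s e ⟩
    (toℕ s + (n ∸ toℕ e)) % n                      ≡⟨ cong (λ z → (z + (n ∸ toℕ e)) % n) (⊖-+ s a) ⟨
    ((toℕ e + toℕ a) % n + (n ∸ toℕ e)) % n        ≡⟨ cong (λ z → (z % n + (n ∸ toℕ e)) % n) (+-comm (toℕ e) (toℕ a)) ⟩
    ((toℕ a + toℕ e) % n + (n ∸ toℕ e)) % n        ≡⟨ %-cancel-complement (toℕ<n a) (m+[n∸m]≡n (<⇒≤ (toℕ<n e))) ⟩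
    toℕ a                                          ∎)
    where
    open ≡-Reasoning
    e = s ⊖ a

-- Splitting on the start lets `column 0F 0F` and `column 1F 2F` reduce to the outer columns `0F`
-- and `3F`.
column : Fin 2 → Fin 3 → Fin 4
column 0F p = inject₁ p
column 1F p = suc p

toℕ-column : ∀ i p → toℕ (column i p) ≡ toℕ i + toℕ p
toℕ-column 0F p = toℕ-inject₁ p
toℕ-column 1F p = refl

module _ {v N : ℕ} (A : Array N 4 v) where

  ρ⇒column : ∀ i x {r} → ρ A (i , x) r → ∀ p → A r (column i p) ≡ lookup x p
  ρ⇒column i x r∈ρ p = r∈ρ (p , toℕ-column i p , refl)

  column⇒ρ : ∀ i x {r} → (∀ p → A r (column i p) ≡ lookup x p) → ρ A (i , x) r
  column⇒ρ i x {r} f (p , j≡i+p , y≡xₚ) =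
    trans (cong (A r) (toℕ-injective (trans j≡i+p (sym (toℕ-column i p)))))
          (trans (f p) (sym y≡xₚ))

  ρ-unique : ∀ i x x′ {r} → ρ A (i , x) r → ρ A (i , x′) r → (i , x) ≡ (i , x′)
  ρ-unique i x x′ q q′ = cong (i ,_)
    (Pointwise-≡⇒≡ (ext λ p → trans (sym (ρ⇒column i x q p)) (ρ⇒column i x′ q′ p)))

  ρ-agree : ∀ i x {r r′} → ρ A (i , x) r → ρ A (i , x) r′ →
            ∀ p → A r (column i p) ≡ A r′ (column i p)
  ρ-agree i x q q′ p = trans (ρ⇒column i x q p) (sym (ρ⇒column i x q′ p))

  OuterEqual : Fin N → Fin N → Set
  OuterEqual r r′ = A r 0F ≡ A r′ 0F × A r 3F ≡ A r′ 3F

  -- With equal starts, one common row already fixes all three symbols. With different starts, one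
  -- interaction fixes column `0F` and the other column `3F`, so two common rows agree in both.
  ρ-common : (T T′ : Interaction 3 4 v) → ∀ {r r′} →
             ρ A T r → ρ A T r′ → ρ A T′ r → ρ A T′ r′ → OuterEqual r r′ ⊎ T′ ≡ T
  ρ-common (0F , x) (0F , x′) p p′ q q′ = inj₂ (ρ-unique 0F x′ x q p)
  ρ-common (1F , x) (1F , x′) p p′ q q′ = inj₂ (ρ-unique 1F x′ x q p)
  ρ-common (0F , x) (1F , x′) p p′ q q′ = inj₁ (ρ-agree 0F x p p′ 0F , ρ-agree 1F x′ q q′ 2F)
  ρ-common (1F , x) (0F , x′) p p′ q q′ = inj₁ (ρ-agree 0F x′ q q′ 0F , ρ-agree 1F x p p′ 2F)

module Construction {m v : ℕ} .{{_ : NonZero v}} (m≤v : m ≤ v) where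

  Row : Set
  Row = Fin (m * v ^ 3)

  -- The row index is a pair: the label, and the number of the triple in the first three columns.
  encode : Fin m → Vec (Fin v) 3 → Row
  encode s x = combine s (funToFin (lookup x))

  label : Row → Fin m
  label r = proj₁ (remQuot (v ^ 3) r)

  inner : Row → Fin 3 → Fin v
  inner r = finToFun (proj₂ (remQuot {m} (v ^ 3) r))

  residue : Fin m → Fin v
  residue s = inject≤ s m≤v

  array : Array (m * v ^ 3) 4 v
  array r 0F = inner r 0F
  array r 1F = inner r 1F
  array r 2F = inner r 2F
  array r 3F = residue (label r) ⊖ inner r 0F

  label-encode : ∀ s x → label (encode s x) ≡ s
  label-encode s x = cong proj₁ (remQuot-combine s (funToFin (lookup x)))

  inner-encode : ∀ s x p → inner (encode s x) p ≡ lookup x p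
  inner-encode s x p =
    trans (cong (λ q → finToFun (proj₂ q) p) (remQuot-combine s (funToFin (lookup x))))
          (finToFun-funToFin (lookup x) p)

  -- The outer entries sum to the residue of the label modulo `v`, and `m ≤ v` keeps distinct labels
  -- distinct as residues.
  label-unique : ∀ {r r′} → OuterEqual array r r′ → label r ≡ label r′
  label-unique {r} {r′} (eq₀ , eq₃) = inject≤-injective m≤v m≤v _ _
    (⊖-cancelʳ (inner r 0F) (trans eq₃ (cong (residue (label r′) ⊖_) (sym eq₀))))

  row : Interaction 3 4 v → Fin m → Row
  row (0F , x)              s = encode s x
  -- The first entry `a` is forced by `a + e ≡ s`.
  row (1F , b ∷ c ∷ e ∷ []) s = encode s (residue s ⊖ e ∷ b ∷ c ∷ [])

  label-row : ∀ T s → label (row T s) ≡ s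
  label-row (0F , x)              s = label-encode s x
  label-row (1F , b ∷ c ∷ e ∷ []) s = label-encode s (residue s ⊖ e ∷ b ∷ c ∷ [])

  row-ρ : ∀ T s → ρ array T (row T s)
  row-ρ (0F , x) s = column⇒ρ array 0F x λ where
    0F → inner-encode s x 0F
    1F → inner-encode s x 1F
    2F → inner-encode s x 2F
  row-ρ (1F , b ∷ c ∷ e ∷ []) s =
   let x = residue s ⊖ e ∷ b ∷ c ∷ [] in column⇒ρ array 1F (b ∷ c ∷ e ∷ []) λ where
    0F → inner-encode s x 1F
    1F → inner-encode s x 2F
    -- The last column of this row is `s - (s - e)`.
    2F → trans (cong₂ (λ s′ a → residue s′ ⊖ a) (label-encode s x) (inner-encode s x 0F))
               (⊖-involutive (residue s) e)

  row-separated : ∀ T T′ {s s′} → s ≢ s′ →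
                  ρ array T′ (row T s) → ρ array T′ (row T s′) → T′ ≡ T
  row-separated T T′ {s} {s′} s≢s′ q q′
    with ρ-common array T T′ (row-ρ T s) (row-ρ T s′) q q′
  ... | inj₂ T′≡T = T′≡T
  ... | inj₁ outer = contradiction
    (trans (sym (label-row T s)) (trans (label-unique outer) (label-row T s′))) s≢s′

mainTheorem15 : (v : ℕ) → 2 ≤ v → (d : ℕ) → 1 ≤ d → d + 1 ≤ v →
    Σ[ A ∈ Array ((d + 1) * v ^ 3) 4 v ] IsOptimumCDA d 3 A
-- Matching `v` with `suc` provides the `NonZero` instance for arithmetic modulo `v`.
mainTheorem15 v@(suc _) _ d _ d+1≤v = array , record
  { isCDA   = separated⇒IsCDA array row row-ρ row-separated
  ; optimum = refl
  }
  where open Construction d+1≤v
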